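{- Let $A$ be a collect algorithm for which $\mathrm{PL}(A)=O(n)$ and $\mathrm{CL}(A)$ is bounded. Then $A$ is $k$-throughput-competitive for the collect object with $k=O\big(\sqrt{\mathrm{CL}(A)}\big)$ (asymptotics in the number of processes $n$).
   Context: Model: $n$ processes communicate through atomic single-writer multi-reader registers, one owned by each process; an execution is an interleaved sequence of steps (each a read or write of one register), ordered by a schedule, i.e., a sequence of process identifiers chosen by an adversary. The collect object: each task is a collect, which returns a value for each of the $n$ registers; a correct implementation ensures every returned value was present in the corresponding register at some time between the start and end of that collect. Each process has a request sequence of tasks and starts a new task as soon as the previous one finishes. $\mathrm{done}(A,\sigma,R)$ is the total number of tasks completed by all processes when running $A$ under schedule $\sigma$ with request sequences $R$; $\mathrm{opt}(\sigma)$ is the maximum of $\mathrm{done}(A^*,\sigma,R^*)$ over all correct implementations $A^*$ and request sequences $R^*$. $A$ is $k$-throughput-competitive if there is a constant $c$ with $\mathrm{done}(A,\sigma,R)+c\ge\frac1k\mathrm{opt}(\sigma)$ for all $\sigma,R$. The collective latency $\mathrm{CL}(A)$ is a bound such that, in every execution and at every time $t$ (time = total number of steps), the total number of read and write operations performed at time $t$ or later by the collects in progress at time $t$ is at most $\mathrm{CL}(A)$. The private latency $\mathrm{PL}(A)$ is the maximum number of operations a single process carries out during one of its own collects. -}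

module Defs where

open import Data.Nat using (ℕ; zero; suc; _+_; _*_; _≤_; _≤?_)
open import Data.Nat.Properties using () renaming (_≟_ to _≟ℕ_)
open import Data.Fin using (Fin)
open import Data.Fin.Properties using () renaming (_≟_ to _≟F_)
open import Data.Bool using (Bool; true; false; if_then_else_; _∧_)
open import Data.Maybe using (Maybe; just; nothing)
open import Data.List using (List; []; _∷_)
open import Data.Product using (_×_; _,_; ∃; ∃-syntax; Σ)
open import Data.Unit using (⊤; tt)
open import Relation.Nullary using (does)
open import Relation.Binary.PropositionalEquality using (_≡_)

-- Shared-memory model for n processes.
--
-- Register j holds an application value (the value a collect must
-- return; it is changed by the environment/adversary, modelled by a
-- value assignment  val : Fin n → ℕ → ℕ  with  val j t  the value in
-- register j at time t) together with algorithm data of type Data,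
-- written only by process j (single-writer).  Time = number of steps
-- taken so far; step number u (0-based) is performed at time u.

data Op (n : ℕ) (Data : Set) : Set where
  read  : Fin n → Op n Data
  write : Data → Op n Data

Resp : ∀ {n Data} → Op n Data → Set
Resp {Data = Data} (read _) = ℕ × Data
Resp (write _) = ⊤

-- A (deterministic) collect algorithm for n processes.  Each process is
-- a state machine; after each of its steps it may complete its current
-- collect, returning a value for every register (and immediately
-- starting its next collect).
record Alg (n : ℕ) : Set₁ where
  field
    State    : Set
    Data     : Set
    initData : Data
    init     : Fin n → State
    op       : State → Op n Data
    trans    : (s : State) → Resp (op s) → State × Maybe (Fin n → ℕ)

Schedule : ℕ → Set
Schedule n = List (Fin n)

Values : ℕ → Set
Values n = Fin n → ℕ → ℕ

-- one event per step: who stepped, the start time of the collect the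
-- step belongs to, and the output if the step completed that collect
record Event (n : ℕ) : Set where
  constructor ev
  field
    proc  : Fin n
    start : ℕ
    out   : Maybe (Fin n → ℕ)
open Event public

upd : ∀ {n} {X : Set} → (Fin n → X) → Fin n → X → Fin n → X
upd f i x j = if does (j ≟F i) then x else f j

module _ {n : ℕ} (A : Alg n) (val : Values n) where
  open Alg A

  run : (Fin n → State) → (Fin n → Data) → (Fin n → ℕ) → ℕ →
        Schedule n → List (Event n)
  run st rg sts t [] = []
  run st rg sts t (i ∷ σ) = go (op (st i)) refl'
    where
      refl' : op (st i) ≡ op (st i)
      refl' = Relation.Binary.PropositionalEquality.refl
      next : Resp (op (st i)) → (Fin n → Data) → List (Event n)
      next r rg' with trans (st i) r
      ... | s' , nothing = ev i (sts i) nothing ∷ run (upd st i s') rg' sts (suc t) σ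
      ... | s' , just o  = ev i (sts i) (just o) ∷
                            run (upd st i s') rg' (upd sts i (suc t)) (suc t) σ
      go : (o : Op n Data) → op (st i) ≡ o → List (Event n)
      go (read j)  e = next (Relation.Binary.PropositionalEquality.subst
                              (λ z → Resp z) (Relation.Binary.PropositionalEquality.sym e)
                              (val j t , rg j)) rg
      go (write d) e = next (Relation.Binary.PropositionalEquality.subst
                              (λ z → Resp z) (Relation.Binary.PropositionalEquality.sym e) tt)
                              (upd rg i d)

  exec : Schedule n → List (Event n)
  exec = run init (λ _ → initData) (λ _ → 0) 0

indexed : ∀ {n} → ℕ → List (Event n) → List (ℕ × Event n)
indexed u [] = []
indexed u (e ∷ es) = (u , e) ∷ indexed (suc u) es

open import Data.List.Membership.Propositional using (_∈_)

countDone : ∀ {n} → List (Event n) → ℕ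
countDone [] = 0
countDone (ev _ _ nothing ∷ es) = countDone es
countDone (ev _ _ (just _) ∷ es) = suc (countDone es)

done : ∀ {n} → Alg n → Schedule n → Values n → ℕ
done A σ val = countDone (exec A val σ)

-- correctness: every value returned by a collect (started at time s,
-- completed by the step at time u, i.e. ending at time u+1) was present
-- in the corresponding register at some time t with s ≤ t ≤ u+1
Correct : ∀ {n} → Alg n → Set
Correct {n} A = ∀ (σ : Schedule n) (val : Values n) (u : ℕ) (e : Event n) →
  (u , e) ∈ indexed 0 (exec A val σ) →
  ∀ o → out e ≡ just o → ∀ j → ∃[ t ] (start e ≤ t × t ≤ suc u × o j ≡ val j t)

opsOf : ∀ {n} → Fin n → ℕ → List (Event n) → ℕ
opsOf i s [] = 0
opsOf i s (e ∷ es) =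
  (if does (proc e ≟F i) ∧ does (start e ≟ℕ s) then 1 else 0) + opsOf i s es

PLBound : ∀ {n} → Alg n → ℕ → Set
PLBound {n} A P = ∀ (σ : Schedule n) (val : Values n) (i : Fin n) (s : ℕ) →
  opsOf i s (exec A val σ) ≤ P

-- operations performed at time ≥ t by collects in progress at time t
-- (i.e. collects started at time ≤ t and containing a step at time ≥ t)
latencyAt : ∀ {n} → ℕ → List (ℕ × Event n) → ℕ
latencyAt t [] = 0
latencyAt t ((u , e) ∷ es) =
  (if does (t ≤? u) ∧ does (start e ≤? t) then 1 else 0) + latencyAt t es

CLBound : ∀ {n} → Alg n → ℕ → Set
CLBound {n} A L = ∀ (σ : Schedule n) (val : Values n) (t : ℕ) →
  latencyAt t (indexed 0 (exec A val σ)) ≤ L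

-- opt(σ) is the supremum of done over all correct algorithms (and inputs);
-- k-throughput-competitiveness:  k · (done(A,σ) + c) ≥ opt(σ)
ThroughputCompetitive : ∀ {n} → Alg n → ℕ → Set₁
ThroughputCompetitive {n} A k = ∃[ c ] (∀ (σ : Schedule n) (val : Values n) →
  (B : Alg n) → Correct B → (val' : Values n) →
  done B σ val' ≤ k * (done A σ val + c))

{-# OPTIONS --safe #-}
module Submission where

-- A correct collect needs every register to be read between its start and its
-- end, since an unread register could have held other values throughout;
-- hence a collect of a competing algorithm B spans at least n steps of the
-- schedule.  Let s = ⌊√L⌋ and cut the schedule into windows of s * n steps.
-- Within one window a process completes at most s collects of B, and if it
-- completes no collect of A there, then all of its steps in the window belong
-- to a collect of A in progress at the start of the window, so the steps of
-- all such processes number at most L.  Thus B completes at most L + s * d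
-- collects in a window in which A completes d.  As A completes a collect at
-- least every PL(A) = O(n) steps of a process, the number of windows is
-- O((D + n) / s), where D counts all completions of A, and L = O(s * s)
-- bounds the total of B by O(s) * (D + n) + L.

open import Defs
open import Data.Nat using (ℕ; _*_; _≤_)
open import Data.Product using (_×_; Σ-syntax)

import Algebra.Properties.Semiring.Sum as Sum
open import Data.Bool using (if_then_else_; _∧_)
open import Data.Fin using (Fin; zero; suc)
open import Data.Fin.Properties using (any?; injective⇒≤; nonZeroIndex) renaming (_≟_ to _≟F_)
open import Data.List using (List; []; _∷_; _++_; length; map; take; drop)
import Data.List as List
open import Data.List.Membership.DecPropositional using () renaming (_∈?_ to ∈?)
open import Data.List.Membership.Propositional using (_∈_; _∉_)
open import Data.List.Membership.Propositional.Properties using (∈-++⁺ˡ; ∈-++⁺ʳ)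
open import Data.List.Properties using (length-++; length-take; length-drop; take++drop≡id)
open import Data.List.Relation.Unary.All as All using (All; []; _∷_)
open import Data.List.Relation.Unary.All.Properties using (++⁻ˡ; ++⁻ʳ)
open import Data.List.Relation.Unary.Any using (here; there; index)
open import Data.List.Relation.Unary.Any.Properties using (lookup-index)
open import Data.Maybe using (Maybe; just; nothing)
open import Data.Nat using (zero; suc; _+_; _∸_; _<_; _⊔_; _/_; _≤?_; _<?_;
  z≤n; s≤s; NonZero; >-nonZero; >-nonZero⁻¹)
open import Data.Nat.DivMod using (_%_; m≡m%n+[m/n]*n; m%n<n; m/n*n≤m)
import Data.Nat.ListAction as ListAction
open import Data.Nat.Properties hiding (≡-irrelevant) renaming (_≟_ to _≟ℕ_)
open import Data.Nat.Tactic.RingSolver using (solve-∀)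
open import Data.Product using (_,_; proj₁; proj₂; ∃-syntax)
open import Data.Sum using (_⊎_; inj₁; inj₂)
open import Data.Unit using (tt)
open import Function using (_∘_; id)
open import Relation.Binary.PropositionalEquality as Eq hiding (trans)
open import Relation.Binary.PropositionalEquality.WithK using (≡-irrelevant)
open import Relation.Nullary using (yes; no; does; ¬_; ¬?; contradiction)
open import Relation.Nullary.Decidable using (dec-true; dec-false; decidable-stable)
open Sum +-*-semiring using (sum; ∑-distrib-+; *-distribˡ-sum)

private variable
  n : ℕ
  X : Set

-- Unfolding the execution

-- The equation is kept in a record, and `outcome` analyses the operation
-- before transporting along it, so that abstracting over `op (st i)` in
-- `run-∷′` leaves the source of the equation alone.
record OpIs (A : Alg n) (s : Alg.State A) (o : Op n (Alg.Data A)) : Set where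
  constructor opIs
  field op≡ : Alg.op A s ≡ o
open OpIs

restart : (Fin n → ℕ) → Fin n → ℕ → Maybe (Fin n → ℕ) → Fin n → ℕ
restart sts p t nothing  = sts
restart sts p t (just _) = upd sts p (suc t)

module _ {n : ℕ} (A : Alg n) where
  open Alg A

  outcome : Values n → (Fin n → Data) → ℕ → (s : State) (o : Op n Data) → OpIs A s o →
            State × Maybe (Fin n → ℕ)
  outcome val rg t s (read j)  h = trans s (subst Resp (sym (op≡ h)) (val j t , rg j))
  outcome val rg t s (write d) h = trans s (subst Resp (sym (op≡ h)) tt)

  registers : (Fin n → Data) → Fin n → Op n Data → Fin n → Data
  registers rg i (read j)  = rg
  registers rg i (write d) = upd rg i d

  continue : Values n → (Fin n → State) → (Fin n → Data) → (Fin n → ℕ) → ℕ →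
             Fin n → Schedule n → State × Maybe (Fin n → ℕ) → List (Event n)
  continue val st rg sts t i σ (s , m) =
    ev i (sts i) m ∷ run A val (upd st i s) rg (restart sts i t m) (suc t) σ

  -- `run` applies a local function to `op (st i)` and a proof of
  -- `op (st i) ≡ op (st i)`; replacing the latter by `op≡ h` allows both
  -- arguments to be generalised together.
  run-∷′ : ∀ val st rg sts t i σ (h : OpIs A (st i) (op (st i))) →
    run A val st rg sts t (i ∷ σ) ≡
    continue val st (registers rg i (op (st i))) sts t i σ
      (outcome val rg t (st i) (op (st i)) h)
  run-∷′ val st rg sts t i σ h rewrite ≡-irrelevant refl (op≡ h) with op (st i) | h
  ... | read j | h′ with trans (st i) (subst Resp (sym (op≡ h′)) (val j t , rg j))
  ... | s , nothing = refl
  ... | s , just o  = refl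
  run-∷′ val st rg sts t i σ h | write d | h′ with trans (st i) (subst Resp (sym (op≡ h′)) tt)
  ... | s , nothing = refl
  ... | s , just o  = refl

  run-∷ : ∀ val st rg sts t i σ →
    run A val st rg sts t (i ∷ σ) ≡
    continue val st (registers rg i (op (st i))) sts t i σ
      (outcome val rg t (st i) (op (st i)) (opIs refl))
  run-∷ val st rg sts t i σ = run-∷′ val st rg sts t i σ (opIs refl)

-- This abstraction of `run` forgets states, registers and values, so that the counting below
-- applies alike to `A` and to its competitor.
data Trace {n : ℕ} : (Fin n → ℕ) → ℕ → Schedule n → List (Event n) → Set where
  []   : ∀ {sts t} → Trace sts t [] []
  step : ∀ {sts t p σ es} m → Trace (restart sts p t m) (suc t) σ es →
         Trace sts t (p ∷ σ) (ev p (sts p) m ∷ es)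

run-trace : ∀ (A : Alg n) val st rg sts t σ → Trace sts t σ (run A val st rg sts t σ)
run-trace A val st rg sts t [] = []
run-trace A val st rg sts t (i ∷ σ) rewrite run-∷ A val st rg sts t i σ =
  step _ (run-trace A val _ _ _ (suc t) σ)

-- Collects of a correct algorithm last at least n steps

indexed-≥ : ∀ {t} (es : List (Event n)) {u e} → (u , e) ∈ indexed t es → t ≤ u
indexed-≥ (_ ∷ es) (here refl) = ≤-refl
indexed-≥ (_ ∷ es) (there x∈)  = <⇒≤ (indexed-≥ es x∈)

AgreeOn : Values n → Values n → List (Fin n) → ℕ → Set
AgreeOn val val′ rs s = ∀ j t → j ∈ rs ⊎ t < s → val j t ≡ val′ j t

module _ {n : ℕ} (A : Alg n) where
  open Alg A

  -- The bound is 1 for a step at time `a` or later and 0 before: an earlier read needs no listed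
  -- register, since agreement before time `a` already fixes its response.
  outcome-depends : ∀ val rg t s o h a → ∃[ rs ] length rs ≤ suc t ∸ (a ⊔ t) ×
    (∀ val′ → AgreeOn val val′ rs a → outcome A val rg t s o h ≡ outcome A val′ rg t s o h)
  outcome-depends val rg t s (write d) h a = [] , z≤n , λ _ _ → refl
  outcome-depends val rg t s (read j) h a with t <? a
  ... | yes t<a = [] , z≤n , λ val′ agree →
    cong (λ v → trans s (subst Resp (sym (op≡ h)) (v , rg j))) (agree j t (inj₂ t<a))
  ... | no t≮a = j ∷ [] , ≤-reflexive one , λ val′ agree →
    cong (λ v → trans s (subst Resp (sym (op≡ h)) (v , rg j))) (agree j t (inj₁ (here refl)))
    where
    one : 1 ≡ suc t ∸ (a ⊔ t)
    one = sym (begin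
      suc t ∸ (a ⊔ t) ≡⟨ cong (suc t ∸_) (m≤n⇒m⊔n≡n (≮⇒≥ t≮a)) ⟩
      suc t ∸ t       ≡⟨ m+n∸n≡m 1 t ⟩
      1               ∎)
      where open ≡-Reasoning

  ∸-⊔-step : ∀ a t u → t < u → (suc t ∸ (a ⊔ t)) + (u ∸ (a ⊔ suc t)) ≤ u ∸ (a ⊔ t)
  ∸-⊔-step a t u t<u with t <? a
  ... | yes t<a rewrite m≥n⇒m⊔n≡m (<⇒≤ t<a) | m≥n⇒m⊔n≡m t<a | m≤n⇒m∸n≡0 t<a = ≤-refl
  ... | no t≮a
    rewrite m≤n⇒m⊔n≡n (≮⇒≥ t≮a) | m≤n⇒m⊔n≡n (m≤n⇒m≤1+n (≮⇒≥ t≮a)) | m+n∸n≡m 1 t =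
    ≤-reflexive (sym (+-∸-assoc 1 t<u))

  -- rs lists the registers read at the steps max(a, t), …, u.
  event-depends : ∀ val st rg sts t σ a {u e} → (u , e) ∈ indexed t (run A val st rg sts t σ) →
    ∃[ rs ] length rs ≤ suc u ∸ (a ⊔ t) ×
    (∀ val′ → AgreeOn val val′ rs a → (u , e) ∈ indexed t (run A val′ st rg sts t σ))
  event-depends val st rg sts t (i ∷ σ) a {u} {e} x∈
    with outcome-depends val rg t (st i) (op (st i)) (opIs refl) a
  ... | rs , rs≤ , same = go (subst (λ es → (u , e) ∈ indexed t es) (run-∷ A val st rg sts t i σ) x∈)
    where
    r = outcome A val rg t (st i) (op (st i)) (opIs refl)
    rg′ = registers A rg i (op (st i))

    -- An equal first outcome leads to the same configuration, because the register data change
    -- through the operation alone; the rest can thus be replayed under `val′`.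
    back : ∀ val′ rs′ → (∀ {j} → j ∈ rs → j ∈ rs′) → AgreeOn val val′ rs′ a →
      (u , e) ∈ indexed t (continue A val′ st rg′ sts t i σ r) →
      (u , e) ∈ indexed t (run A val′ st rg sts t (i ∷ σ))
    back val′ rs′ rs⊆ agree rewrite run-∷ A val′ st rg sts t i σ
      | same val′ (λ { j t′ (inj₁ j∈) → agree j t′ (inj₁ (rs⊆ j∈))
                     ; j t′ (inj₂ t<) → agree j t′ (inj₂ t<) }) = id

    go : (u , e) ∈ indexed t (continue A val st rg′ sts t i σ r) →
      ∃[ rs ] length rs ≤ suc u ∸ (a ⊔ t) ×
      (∀ val′ → AgreeOn val val′ rs a → (u , e) ∈ indexed t (run A val′ st rg sts t (i ∷ σ)))
    go (here refl) = rs , rs≤ , λ val′ agree → back val′ rs id agree (here refl)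
    go (there y∈) with event-depends val _ _ _ (suc t) σ a y∈
    ... | rs₂ , rs₂≤ , same₂ = rs ++ rs₂ ,
      (begin
        length (rs ++ rs₂)                        ≡⟨ length-++ rs ⟩
        length rs + length rs₂                    ≤⟨ +-mono-≤ rs≤ rs₂≤ ⟩
        (suc t ∸ (a ⊔ t)) + (suc u ∸ (a ⊔ suc t)) ≤⟨ ∸-⊔-step a t (suc u) (m≤n⇒m≤1+n (indexed-≥ _ y∈)) ⟩
        suc u ∸ (a ⊔ t)                           ∎) ,
      λ val′ agree → back val′ (rs ++ rs₂) ∈-++⁺ˡ agree
        (there (same₂ val′ λ { j t′ (inj₁ j∈) → agree j t′ (inj₁ (∈-++⁺ʳ rs j∈))
                             ; j t′ (inj₂ t<) → agree j t′ (inj₂ t<) }))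
      where open ≤-Reasoning

-- Pigeonhole: otherwise sending each `j` to a position in `js` would inject `Fin n` into a smaller
-- `Fin`.
missing-element : (js : List (Fin n)) → length js < n → ∃[ j ] j ∉ js
missing-element js js< with any? (λ j → ¬? (∈? _≟F_ j js))
... | yes missing = missing
... | no ¬missing = contradiction (injective⇒≤ index-injective) (<⇒≱ js<)
  where
  covered : ∀ j → j ∈ js
  covered j = decidable-stable (∈? _≟F_ j js) (λ j∉ → ¬missing (j , j∉))

  index-injective : ∀ {i j} → index (covered i) ≡ index (covered j) → i ≡ j
  index-injective {i} {j} eq = begin
    i                                  ≡⟨ lookup-index (covered i) ⟩
    List.lookup js (index (covered i)) ≡⟨ cong (List.lookup js) eq ⟩
    List.lookup js (index (covered j)) ≡⟨ lookup-index (covered j) ⟨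
    j                                  ∎
    where open ≡-Reasoning

Spaced : ℕ × Event n → Set
Spaced {n} (u , e) = ∀ o → out e ≡ just o → start e + n ≤ suc u

correct⇒spaced : (B : Alg n) → Correct B → ∀ val σ → All Spaced (indexed 0 (exec B val σ))
correct⇒spaced {n} B correct val σ = All.tabulate λ {x} x∈ o out≡ →
  ≮⇒≥ (too-short (proj₁ x) (proj₂ x) x∈ o out≡)
  where
  too-short : ∀ u e → (u , e) ∈ indexed 0 (exec B val σ) → ∀ o → out e ≡ just o →
    ¬ (suc u < start e + n)
  too-short u e x∈ o out≡ short
    with event-depends B val _ _ _ 0 σ (start e) x∈
  ... | rs , rs≤ , same with missing-element rs (≤-<-trans rs≤ fewer)
    where
    instance
      n≢0 : NonZero n
      n≢0 = nonZeroIndex (proc e)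
    fewer : suc u ∸ (start e ⊔ 0) < n
    fewer rewrite ⊔-identityʳ (start e) = m<n+o⇒m∸n<o (suc u) (start e) short
  ... | j , j∉ = absurd (correct σ val′ u e (same val′ agree) o out≡ j)
    where
    val′ : Values n
    -- From `start e` on, register `j` never holds the returned `o j`. Earlier values are kept,
    -- since reads of `j` before `start e` may have influenced the run.
    val′ i t = if does (i ≟F j) ∧ does (start e ≤? t) then suc (o j) else val i t

    agree : AgreeOn val val′ rs (start e)
    agree i t (inj₁ i∈) with i ≟F j
    ... | yes refl = contradiction i∈ j∉
    ... | no _ = refl
    agree i t (inj₂ t<) with i ≟F j
    ... | no _ = refl
    ... | yes _ rewrite dec-false (start e ≤? t) (<⇒≱ t<) = refl

    absurd : ¬ (∃[ t ] (start e ≤ t × t ≤ suc u × o j ≡ val′ j t))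
    absurd (t , s≤t , _ , eq)
      rewrite dec-true (j ≟F j) refl | dec-true (start e ≤? t) s≤t = 1+n≢n (sym eq)

-- Tallies per process

-- One tally serves steps, completions and pending operations, so that summation over processes is
-- handled once, in `∑-tallyBy`.
tallyBy : (X → Fin n) → (X → ℕ) → Fin n → List X → ℕ
tallyBy key w i []       = 0
tallyBy key w i (x ∷ xs) = (if does (key x ≟F i) then w x else 0) + tallyBy key w i xs

∑-zero : ∀ n → sum {n} (λ _ → 0) ≡ 0
∑-zero zero    = refl
∑-zero (suc n) = ∑-zero n

∑-point : ∀ (p : Fin n) c → sum (λ i → if does (p ≟F i) then c else 0) ≡ c
∑-point {suc n} zero c = begin
  c + sum {n} (λ _ → 0) ≡⟨ cong (c +_) (∑-zero n) ⟩
  c + 0                 ≡⟨ +-identityʳ c ⟩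
  c                     ∎
  where open ≡-Reasoning
∑-point {suc n} (suc p) c = ∑-point p c

∑-mono : ∀ {f g : Fin n → ℕ} → (∀ i → f i ≤ g i) → sum f ≤ sum g
∑-mono {zero}  f≤g = z≤n
∑-mono {suc n} f≤g = +-mono-≤ (f≤g zero) (∑-mono (f≤g ∘ suc))

∑-one : ∀ n → sum {n} (λ _ → 1) ≡ n
∑-one zero    = refl
∑-one (suc n) = cong suc (∑-one n)

∑-tallyBy : ∀ (key : X → Fin n) w xs → sum (λ i → tallyBy key w i xs) ≡ ListAction.sum (map w xs)
∑-tallyBy {n = n} key w []       = ∑-zero n
∑-tallyBy key w (x ∷ xs) = begin
  sum (λ i → (if does (key x ≟F i) then w x else 0) + tallyBy key w i xs)
    ≡⟨ ∑-distrib-+ (λ i → if does (key x ≟F i) then w x else 0) (λ i → tallyBy key w i xs) ⟩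
  sum (λ i → if does (key x ≟F i) then w x else 0) + sum (λ i → tallyBy key w i xs)
    ≡⟨ cong₂ _+_ (∑-point (key x) (w x)) (∑-tallyBy key w xs) ⟩
  w x + ListAction.sum (map w xs) ∎
  where open ≡-Reasoning

stepsOf : Fin n → Schedule n → ℕ
stepsOf = tallyBy id (λ _ → 1)

∑-stepsOf : ∀ (σ : Schedule n) → sum (λ i → stepsOf i σ) ≡ length σ
∑-stepsOf σ = Eq.trans (∑-tallyBy id (λ _ → 1) σ) (ones σ)
  where
  ones : ∀ σ → ListAction.sum (map (λ _ → 1) σ) ≡ length σ
  ones []      = refl
  ones (_ ∷ σ) = cong suc (ones σ)

completions : Event n → ℕ
completions (ev _ _ nothing)  = 0
completions (ev _ _ (just _)) = 1

doneBy : Fin n → List (Event n) → ℕ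
doneBy = tallyBy proc completions

∑-doneBy : ∀ (es : List (Event n)) → sum (λ i → doneBy i es) ≡ countDone es
∑-doneBy es = Eq.trans (∑-tallyBy proc completions es) (counts es)
  where
  counts : ∀ es → ListAction.sum (map completions es) ≡ countDone es
  counts []                     = refl
  counts (ev _ _ nothing ∷ es)  = counts es
  counts (ev _ _ (just _) ∷ es) = cong suc (counts es)

pending : ℕ → ℕ × Event n → ℕ
pending τ (u , e) = if does (τ ≤? u) ∧ does (start e ≤? τ) then 1 else 0

latencyBy : ℕ → Fin n → List (ℕ × Event n) → ℕ
latencyBy τ = tallyBy (proc ∘ proj₂) (pending τ)

∑-latencyBy : ∀ τ (xs : List (ℕ × Event n)) → sum (λ i → latencyBy τ i xs) ≡ latencyAt τ xs
∑-latencyBy τ xs = Eq.trans (∑-tallyBy (proc ∘ proj₂) (pending τ) xs) (total xs)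
  where
  total : ∀ xs → ListAction.sum (map (pending τ) xs) ≡ latencyAt τ xs
  total []       = refl
  total (x ∷ xs) = cong (pending τ x +_) (total xs)

-- Steps and completions of one process

restart-≤ : ∀ {sts : Fin n → ℕ} {t} p m → (∀ i → sts i ≤ t) → ∀ i → restart sts p t m i ≤ suc t
restart-≤ p nothing  sts≤ i = m≤n⇒m≤1+n (sts≤ i)
restart-≤ p (just _) sts≤ i with i ≟F p
... | yes _ = ≤-refl
... | no _  = m≤n⇒m≤1+n (sts≤ i)

restart-other : ∀ {sts : Fin n → ℕ} {p i} t m → p ≢ i → restart sts p t m i ≡ sts i
restart-other t nothing p≢i = refl
restart-other {p = p} {i} t (just _) p≢i rewrite dec-false (i ≟F p) (p≢i ∘ sym) = refl

restart-self : ∀ (sts : Fin n → ℕ) p t o → restart sts p t (just o) p ≡ suc t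
restart-self sts p t o rewrite dec-true (p ≟F p) refl = refl

-- Every step of `i` lies in the collect open at time `t` or in one begun after a completion; each
-- completion is charged the at most `P` steps of the collect that follows it.
steps≤ops : ∀ {sts : Fin n → ℕ} {t σ es} P i → Trace sts t σ es → (∀ a → opsOf i a es ≤ P) →
  stepsOf i σ ≤ opsOf i (sts i) es + P * doneBy i es
steps≤ops P i [] ops≤ = z≤n
steps≤ops {sts = sts} {t} P i (step {p = p} {σ} {es} m tr) ops≤
  with ih ← steps≤ops P i tr (λ a → ≤-trans (m≤n+m _ _) (ops≤ a)) | p ≟F i
... | no p≢i = 
  subst (λ a → stepsOf i σ ≤ opsOf i a es + P * doneBy i es) (restart-other t m p≢i) ih
steps≤ops {sts = sts} P i (step nothing tr) ops≤ | yes refl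
  rewrite dec-true (sts i ≟ℕ sts i) refl = s≤s ih
steps≤ops {sts = sts} P i (step {σ = σ} {es} (just o) tr) ops≤ | yes refl
  rewrite dec-true (sts i ≟ℕ sts i) refl = s≤s (begin
    stepsOf i σ                            ≤⟨ ih ⟩
    opsOf i _ es + P * doneBy i es         ≤⟨ +-monoˡ-≤ _ (≤-trans (m≤n+m _ _) (ops≤ _)) ⟩
    P + P * doneBy i es                    ≡⟨ *-suc P _ ⟨
    P * suc (doneBy i es)                  ≤⟨ m≤n+m _ _ ⟩
    opsOf i (sts i) es + P * suc (doneBy i es) ∎)
  where open ≤-Reasoning

-- A process takes steps in at most one collect more than it completes; over all processes these
-- extra collects give the summand `n`.
length≤ops : ∀ {sts : Fin n → ℕ} {t σ es} P → Trace sts t σ es → (∀ i a → opsOf i a es ≤ P) →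
  length σ ≤ P * (n + countDone es)
length≤ops {n} {sts} {t} {σ} {es} P tr ops≤ = begin
  length σ                               ≡⟨ ∑-stepsOf σ ⟨
  sum (λ i → stepsOf i σ)                ≤⟨ ∑-mono bound ⟩
  sum (λ i → P * (1 + doneBy i es))      ≡⟨ *-distribˡ-sum P (λ i → 1 + doneBy i es) ⟨
  P * sum (λ i → 1 + doneBy i es)        ≡⟨ cong (P *_) (∑-distrib-+ (λ _ → 1) (λ i → doneBy i es)) ⟩
  P * (sum {n} (λ _ → 1) + sum (λ i → doneBy i es))
    ≡⟨ cong (P *_) (cong₂ _+_ (∑-one n) (∑-doneBy es)) ⟩
  P * (n + countDone es)                 ∎
  where
  open ≤-Reasoning
  bound : ∀ i → stepsOf i σ ≤ P * (1 + doneBy i es)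
  bound i = begin
    stepsOf i σ                             ≤⟨ steps≤ops P i tr (ops≤ i) ⟩
    opsOf i (sts i) es + P * doneBy i es    ≤⟨ +-monoˡ-≤ _ (ops≤ i _) ⟩
    P + P * doneBy i es                     ≡⟨ *-suc P _ ⟨
    P * (1 + doneBy i es)                   ∎

-- Until `i` completes a collect its start time does not move, so each of its steps counts as
-- pending at `τ`. The induction advances `t` while `τ`, the start of the window, stays fixed.
steps-pending-or-done : ∀ {sts : Fin n → ℕ} {t σ es} τ i → Trace sts t σ es → τ ≤ t → sts i ≤ τ →
  stepsOf i σ ≤ latencyBy τ i (indexed t es) ⊎ 1 ≤ doneBy i es
steps-pending-or-done τ i [] τ≤t s≤τ = inj₁ z≤n
steps-pending-or-done {sts = sts} {t} τ i (step {p = p} m tr) τ≤t s≤τ with p ≟F i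
... | no p≢i = steps-pending-or-done τ i tr (m≤n⇒m≤1+n τ≤t)
                 (≤-trans (≤-reflexive (restart-other t m p≢i)) s≤τ)
steps-pending-or-done {sts = sts} {t} τ i (step (just o) tr) τ≤t s≤τ | yes refl = inj₂ (s≤s z≤n)
steps-pending-or-done {sts = sts} {t} τ i (step nothing tr) τ≤t s≤τ | yes refl
  rewrite dec-true (τ ≤? t) τ≤t | dec-true (sts i ≤? τ) s≤τ
  with steps-pending-or-done τ i tr (m≤n⇒m≤1+n τ≤t) s≤τ
... | inj₁ le = inj₁ (s≤s le)
... | inj₂ le = inj₂ le

done≤steps : ∀ {sts : Fin n → ℕ} {t σ es} i → Trace sts t σ es → doneBy i es ≤ stepsOf i σ
done≤steps i [] = z≤n
done≤steps i (step {p = p} m tr) with p ≟F i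
... | no _ = done≤steps i tr
done≤steps i (step nothing tr)  | yes _ = m≤n⇒m≤1+n (done≤steps i tr)
done≤steps i (step (just _) tr) | yes _ = s≤s (done≤steps i tr)

-- Each completion moves the start time of `i` forward by at least `n`, and this start time never
-- passes the current time, which ends at `length σ + t`.
spaced-done : ∀ {sts : Fin n → ℕ} {t σ es} i → Trace sts t σ es → All Spaced (indexed t es) →
  sts i ≤ t → doneBy i es * n + sts i ≤ length σ + t
spaced-done i [] _ s≤t = s≤t
spaced-done {n} {sts} {t} i (step {p = p} {σ} {es} m tr) (sp ∷ sps) s≤t
  rewrite sym (+-suc (length σ) t) with p ≟F i
... | no p≢i = subst (λ a → doneBy i es * n + a ≤ length σ + suc t) (restart-other t m p≢i)
  (spaced-done i tr sps (≤-trans (≤-reflexive (restart-other t m p≢i)) (m≤n⇒m≤1+n s≤t)))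
spaced-done i (step nothing tr) (sp ∷ sps) s≤t | yes refl =
  spaced-done i tr sps (m≤n⇒m≤1+n s≤t)
spaced-done {n} {sts} {t} i (step {σ = σ} {es} (just o) tr) (sp ∷ sps) s≤t | yes refl = begin
  (n + doneBy i es * n) + sts i ≡⟨ rearrange n (doneBy i es * n) (sts i) ⟩
  doneBy i es * n + (sts i + n) ≤⟨ +-monoʳ-≤ (doneBy i es * n) (sp o refl) ⟩
  doneBy i es * n + suc t       ≡⟨ cong (doneBy i es * n +_) (restart-self sts i t o) ⟨
  doneBy i es * n + restart sts i t (just o) i
    ≤⟨ spaced-done i tr sps (≤-reflexive (restart-self sts i t o)) ⟩
  length σ + suc t              ∎
  where
  open ≤-Reasoning
  rearrange : ∀ a b c → (a + b) + c ≡ b + (c + a)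
  rearrange = solve-∀

-- The first completion may end a collect begun long before t, hence the extra n.
window-done : .{{NonZero n}} → ∀ {sts : Fin n → ℕ} {t σ es} i → Trace sts t σ es →
  All Spaced (indexed t es) → doneBy i es * n < length σ + n
window-done {n} i [] _ = >-nonZero⁻¹ n
window-done {n} {sts} {t} i (step {p = p} {σ} {es} m tr) (sp ∷ sps) with p ≟F i
... | no _ = m≤n⇒m≤1+n (window-done i tr sps)
window-done i (step nothing tr) (sp ∷ sps) | yes refl = m≤n⇒m≤1+n (window-done i tr sps)
window-done {n} {sts} {t} i (step {σ = σ} {es} (just o) tr) (sp ∷ sps) | yes refl = s≤s (begin
  n + doneBy i es * n ≤⟨ +-monoʳ-≤ n (+-cancelʳ-≤ (suc t) _ _ (begin
      doneBy i es * n + suc t ≡⟨ cong (doneBy i es * n +_) (restart-self sts i t o) ⟨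
      doneBy i es * n + restart sts i t (just o) i
        ≤⟨ spaced-done i tr sps (≤-reflexive (restart-self sts i t o)) ⟩
      length σ + suc t ∎)) ⟩
  n + length σ        ≡⟨ +-comm n (length σ) ⟩
  length σ + n        ∎)
  where open ≤-Reasoning

-- Cutting the schedule into windows

window-bound : .{{NonZero n}} → ∀ {sts sts′ : Fin n → ℕ} {t σ es fs} s →
  Trace sts t σ es → Trace sts′ t σ fs → (∀ i → sts i ≤ t) → All Spaced (indexed t fs) →
  length σ ≤ s * n → countDone fs ≤ latencyAt t (indexed t es) + s * countDone es
window-bound {n} {sts} {sts′} {t} {σ} {es} {fs} s trA trB sts≤ spaced short = begin
  countDone fs ≡⟨ ∑-doneBy fs ⟨
  sum (λ i → doneBy i fs) ≤⟨ ∑-mono bound ⟩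
  sum (λ i → latencyBy t i (indexed t es) + s * doneBy i es)
    ≡⟨ ∑-distrib-+ (λ i → latencyBy t i (indexed t es)) (λ i → s * doneBy i es) ⟩
  sum (λ i → latencyBy t i (indexed t es)) + sum (λ i → s * doneBy i es)
    ≡⟨ cong₂ _+_ (∑-latencyBy t (indexed t es)) (sym (*-distribˡ-sum s (λ i → doneBy i es))) ⟩
  latencyAt t (indexed t es) + s * sum (λ i → doneBy i es)
    ≡⟨ cong (λ d → latencyAt t (indexed t es) + s * d) (∑-doneBy es) ⟩
  latencyAt t (indexed t es) + s * countDone es ∎
  where
  open ≤-Reasoning
  -- The strictness in `window-done` gives `s` here rather than `suc s`.
  at-most-s : ∀ i → doneBy i fs ≤ s
  at-most-s i = m<1+n⇒m≤n (*-cancelʳ-< n _ _ (begin-strict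
    doneBy i fs * n <⟨ window-done i trB spaced ⟩
    length σ + n    ≤⟨ +-monoˡ-≤ n short ⟩
    s * n + n       ≡⟨ +-comm (s * n) n ⟩
    suc s * n       ∎))
  bound : ∀ i → doneBy i fs ≤ latencyBy t i (indexed t es) + s * doneBy i es
  -- In the first case each completion in `fs` is charged to a pending step; in the second all of
  -- them, at most `s`, are charged to a completion in `es`.
  bound i with steps-pending-or-done t i trA ≤-refl (sts≤ i)
  ... | inj₁ le = ≤-trans (done≤steps i trB) (≤-trans le (m≤m+n _ _))
  ... | inj₂ le = begin
    doneBy i fs                                       ≤⟨ at-most-s i ⟩
    s                                                 ≡⟨ *-identityʳ s ⟨
    s * 1                                             ≤⟨ *-monoʳ-≤ s le ⟩
    s * doneBy i es                                   ≤⟨ m≤n+m _ _ ⟩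
    latencyBy t i (indexed t es) + s * doneBy i es    ∎

trace-length : ∀ {sts : Fin n → ℕ} {t σ es} → Trace sts t σ es → length es ≡ length σ
trace-length []          = refl
trace-length (step m tr) = cong suc (trace-length tr)

record Split {n} (sts : Fin n → ℕ) (t : ℕ) (σ₁ σ₂ : Schedule n) (es : List (Event n)) : Set where
  constructor split
  field
    {es₁ es₂} : List (Event n)
    {sts₂}    : Fin n → ℕ
    es≡       : es ≡ es₁ ++ es₂
    prefix    : Trace sts t σ₁ es₁
    sts₂≤     : ∀ i → sts₂ i ≤ length σ₁ + t
    suffix    : Trace sts₂ (length σ₁ + t) σ₂ es₂

split-trace : ∀ {sts : Fin n → ℕ} {t σ₂ es} σ₁ → (∀ i → sts i ≤ t) → Trace sts t (σ₁ ++ σ₂) es →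
  Split sts t σ₁ σ₂ es
split-trace []       sts≤ tr = split refl [] sts≤ tr
split-trace {t = t} (p ∷ σ₁) sts≤ (step m tr)
  with split eq tr₁ le tr₂ ← split-trace σ₁ (restart-≤ p m sts≤) tr
  rewrite +-suc (length σ₁) t = split (cong (_ ∷_) eq) (step m tr₁) le tr₂

countDone-++ : ∀ (es fs : List (Event n)) → countDone (es ++ fs) ≡ countDone es + countDone fs
countDone-++ []                     fs = refl
countDone-++ (ev _ _ nothing ∷ es)  fs = countDone-++ es fs
countDone-++ (ev _ _ (just _) ∷ es) fs = cong suc (countDone-++ es fs)

indexed-++ : ∀ t (es fs : List (Event n)) →
  indexed t (es ++ fs) ≡ indexed t es ++ indexed (length es + t) fs
indexed-++ t []       fs = refl
indexed-++ t (e ∷ es) fs rewrite indexed-++ (suc t) es fs | +-suc (length es) t = refl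

latencyAt-++ : ∀ τ (xs ys : List (ℕ × Event n)) →
  latencyAt τ (xs ++ ys) ≡ latencyAt τ xs + latencyAt τ ys
latencyAt-++ τ []       ys = refl
latencyAt-++ τ (x ∷ xs) ys rewrite latencyAt-++ τ xs ys = sym (+-assoc (pending τ x) _ _)

indexed-split : ∀ {sts : Fin n → ℕ} {t σ es} → Trace sts t σ es → ∀ fs →
  indexed t (es ++ fs) ≡ indexed t es ++ indexed (length σ + t) fs
indexed-split {t = t} {es = es} tr fs rewrite sym (trace-length tr) = indexed-++ t es fs

-- Induction on the number `W` of windows, both traces being cut after the same `s * n` schedule
-- entries. Latency is bounded at every `τ` because each window uses its own starting time. Windows
-- at the end may be short or empty.
windows-bound : .{{NonZero n}} → ∀ {sts sts′ : Fin n → ℕ} {t es fs} s L W σ →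
  Trace sts t σ es → Trace sts′ t σ fs → (∀ i → sts i ≤ t) → (∀ i → sts′ i ≤ t) →
  All Spaced (indexed t fs) → (∀ τ → latencyAt τ (indexed t es) ≤ L) →
  length σ ≤ W * (s * n) → countDone fs ≤ W * L + s * countDone es
windows-bound s L zero [] trA [] _ _ _ _ _ = z≤n
windows-bound {n} {t = t} s L (suc W) σ trA trB sts≤ sts′≤ spaced lat short
  with split {es₁} {es₂} refl trA₁ ≤A trA₂ ← split-trace (take (s * n) σ) sts≤
         (subst (λ σ → Trace _ _ σ _) (sym (take++drop≡id (s * n) σ)) trA)
     | split {fs₁} {fs₂} refl trB₁ ≤B trB₂ ← split-trace (take (s * n) σ) sts′≤
         (subst (λ σ → Trace _ _ σ _) (sym (take++drop≡id (s * n) σ)) trB) = begin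
  countDone (fs₁ ++ fs₂)      ≡⟨ countDone-++ fs₁ fs₂ ⟩
  countDone fs₁ + countDone fs₂ ≤⟨ +-mono-≤ first rest ⟩
  (L + s * countDone es₁) + (W * L + s * countDone es₂)
    ≡⟨ rearrange L s (countDone es₁) (W * L) (countDone es₂) ⟩
  (L + W * L) + s * (countDone es₁ + countDone es₂)
    ≡⟨ cong (λ d → (L + W * L) + s * d) (countDone-++ es₁ es₂) ⟨
  suc W * L + s * countDone (es₁ ++ es₂) ∎
  where
  open ≤-Reasoning
  t₂ = length (take (s * n) σ) + t

  rearrange : ∀ a b c d e → (a + b * c) + (d + b * e) ≡ (a + d) + b * (c + e)
  rearrange = solve-∀

  spaced-++ : All Spaced (indexed t fs₁ ++ indexed t₂ fs₂)
  spaced-++ = subst (All Spaced) (indexed-split trB₁ fs₂) spaced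

  -- Latency is additive over the two pieces, so `L` bounds each: the first serves this window, the
  -- second the induction hypothesis.
  lat-++ : ∀ τ → latencyAt τ (indexed t es₁) + latencyAt τ (indexed t₂ es₂) ≤ L
  lat-++ τ = begin
    latencyAt τ (indexed t es₁) + latencyAt τ (indexed t₂ es₂)
      ≡⟨ latencyAt-++ τ (indexed t es₁) (indexed t₂ es₂) ⟨
    latencyAt τ (indexed t es₁ ++ indexed t₂ es₂)
      ≡⟨ cong (latencyAt τ) (indexed-split trA₁ es₂) ⟨
    latencyAt τ (indexed t (es₁ ++ es₂)) ≤⟨ lat τ ⟩
    L ∎

  first : countDone fs₁ ≤ L + s * countDone es₁
  first = begin
    countDone fs₁
      ≤⟨ window-bound s trA₁ trB₁ sts≤ (++⁻ˡ (indexed t fs₁) spaced-++)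
           (≤-trans (≤-reflexive (length-take (s * n) σ)) (m⊓n≤m (s * n) (length σ))) ⟩
    latencyAt t (indexed t es₁) + s * countDone es₁
      ≤⟨ +-monoˡ-≤ _ (≤-trans (m≤m+n _ _) (lat-++ t)) ⟩
    L + s * countDone es₁ ∎

  rest : countDone fs₂ ≤ W * L + s * countDone es₂
  rest = windows-bound s L W (drop (s * n) σ) trA₂ trB₂ ≤A ≤B (++⁻ʳ (indexed t fs₁) spaced-++)
    (λ τ → ≤-trans (m≤n+m _ _) (lat-++ τ))
    (≤-trans (≤-reflexive (length-drop (s * n) σ)) (m≤n+o⇒m∸n≤o (length σ) (s * n) short))

-- The competitive ratio

integer-sqrt : ∀ m → ∃[ s ] s * s ≤ m × m < suc s * suc s
integer-sqrt zero = 0 , z≤n , s≤s z≤n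
integer-sqrt (suc m) with s , s²≤ , <s² ← integer-sqrt m | suc s * suc s ≤? suc m
... | yes ≤m = suc s , ≤m , ≤-<-trans <s² (*-mono-< (n<1+n (suc s)) (n<1+n (suc s)))
... | no ≰m  = s , m≤n⇒m≤1+n s²≤ , ≰⇒> ≰m

round-up : ∀ m d .{{_ : NonZero d}} → m ≤ suc (m / d) * d
round-up m d = begin
  m                   ≡⟨ m≡m%n+[m/n]*n m d ⟩
  m % d + (m / d) * d ≤⟨ +-monoˡ-≤ ((m / d) * d) (<⇒≤ (m%n<n m d)) ⟩
  suc (m / d) * d     ∎
  where open ≤-Reasoning

-- `Ws≤` counts the full windows by their `s * n` steps and, with `L ≤ 4 * (s * s)`, turns `W * L`
-- into at most `4 * s * (C * (n + D))`. The additive constant `n + L` absorbs the unfinished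
-- collects and the one window beyond the full ones.
competitive : .{{NonZero n}} → (A : Alg n) → ∀ C P L s .{{_ : NonZero s}} → PLBound A P → CLBound A L →
  P ≤ C * n → L ≤ 4 * (s * s) → ThroughputCompetitive A (s * suc (4 * C))
competitive {n} A C P L s pl cl P≤ L≤ = n + L , λ σ val B correct val′ →
  let D = done A σ val
      W = length σ / (s * n)
      trA = run-trace A val _ _ (λ _ → 0) 0 σ
      trB = run-trace B val′ _ _ (λ _ → 0) 0 σ
      Ws≤ : W * s ≤ C * (n + D)
      Ws≤ = *-cancelʳ-≤ _ _ n (begin
        W * s * n         ≡⟨ *-assoc W s n ⟩
        W * (s * n)       ≤⟨ m/n*n≤m (length σ) (s * n) ⟩
        length σ          ≤⟨ length≤ops P trA (pl σ val) ⟩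
        P * (n + D)       ≤⟨ *-monoˡ-≤ (n + D) P≤ ⟩
        C * n * (n + D)   ≡⟨ swap C n (n + D) ⟩
        C * (n + D) * n   ∎)
  in begin
    done B σ val′
      ≤⟨ windows-bound s L (suc W) σ trA trB (λ _ → z≤n) (λ _ → z≤n)
           (correct⇒spaced B correct val′ σ) (cl σ val)
           (round-up (length σ) (s * n)) ⟩
    (L + W * L) + s * D
      -- The `L` of the extra window is raised to `s * L` so that `s` becomes a common factor.
      ≤⟨ +-monoˡ-≤ (s * D) (+-mono-≤ (m≤n*m L s) (*-monoʳ-≤ W L≤)) ⟩
    (s * L + W * (4 * (s * s))) + s * D
      ≡⟨ cong (λ x → (s * L + x) + s * D) (regroup W s) ⟩
    (s * L + 4 * s * (W * s)) + s * D
      ≤⟨ +-monoˡ-≤ (s * D) (+-monoʳ-≤ (s * L) (*-monoʳ-≤ (4 * s) Ws≤)) ⟩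
    (s * L + 4 * s * (C * (n + D))) + s * D
      -- The added terms are exactly what the expanded target has beyond the left side.
      ≤⟨ m≤m+n _ (s * n + 4 * s * C * L) ⟩
    (s * L + 4 * s * (C * (n + D))) + s * D + (s * n + 4 * s * C * L)
      ≡⟨ collect s L C n D ⟩
    s * suc (4 * C) * (D + (n + L)) ∎
  where
  open ≤-Reasoning
  instance
    window≢0 : NonZero (s * n)
    window≢0 = m*n≢0 s n
  swap : ∀ a b c → a * b * c ≡ a * c * b
  swap = solve-∀
  regroup : ∀ w s → w * (4 * (s * s)) ≡ 4 * s * (w * s)
  regroup = solve-∀
  collect : ∀ s L C n D →
    (s * L + 4 * s * (C * (n + D))) + s * D + (s * n + 4 * s * C * L) ≡
    s * suc (4 * C) * (D + (n + L))
  collect = solve-∀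

-- A single first step belongs to a collect started at time 0 and is pending at time 0. Hence the
-- integer root of `L` is at least 1 and windows are nonempty.
latency-positive : .{{NonZero n}} → (A : Alg n) → ∀ {L} → CLBound A L → 0 < L
latency-positive {suc n} A cl
  with exec A (λ _ _ → 0) (zero ∷ [])
     | run-trace A (λ _ _ → 0) (Alg.init A) (λ _ → Alg.initData A) (λ _ → 0) 0 (zero ∷ [])
     | cl (zero ∷ []) (λ _ _ → 0) 0
... | _ | step _ [] | 0<L = 0<L

theorem2 : (A : (n : ℕ) → Alg n) → (∀ n → Correct (A n)) →
    (P L : ℕ → ℕ) → (∀ n → PLBound (A n) (P n)) → (∀ n → CLBound (A n) (L n)) →
    (Σ[ C₀ ∈ ℕ ] Σ[ N₀ ∈ ℕ ] (∀ n → N₀ ≤ n → P n ≤ C₀ * n)) →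
    Σ[ C ∈ ℕ ] Σ[ N ∈ ℕ ] Σ[ k ∈ (ℕ → ℕ) ] (∀ n → N ≤ n →
    (k n * k n ≤ C * L n) × ThroughputCompetitive (A n) (k n))
theorem2 A _ P L pl cl (C , N , P≤) =
  -- The constant is the square of the factor `suc (4 * C)` in `k`; `N ⊔ 1` excludes `n = 0`, where
  -- `latency-positive` would fail.
  suc (4 * C) * suc (4 * C) , N ⊔ 1 , (λ n → √ (L n) * suc (4 * C)) , λ n N≤n →
  let instance
        n≢0 : NonZero n
        n≢0 = >-nonZero (≤-trans (m≤n⊔m N 1) N≤n)
        s≢0 : NonZero (√ (L n))
        s≢0 = √-nonZero (L n) (latency-positive (A n) (cl n))
  in ratio (L n) , competitive (A n) C (P n) (L n) (√ (L n)) (pl n) (cl n)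
       (P≤ n (≤-trans (m≤m⊔n N 1) N≤n)) (≤-four-squares (L n))
  where
  √ : ℕ → ℕ
  √ m = proj₁ (integer-sqrt m)

  √-nonZero : ∀ m → 0 < m → NonZero (√ m)
  √-nonZero m 0<m with integer-sqrt m
  ... | zero  , _ , m<1 = contradiction m<1 (≤⇒≯ 0<m)
  ... | suc _ , _       = _

  -- As the root `s` is at least 1, `suc s ≤ s + s`; this doubling is the source of the 4 in the
  -- ratio.
  ≤-four-squares : ∀ m → .{{NonZero (√ m)}} → m ≤ 4 * (√ m * √ m)
  ≤-four-squares m with s@(suc r) , _ , m< ← integer-sqrt m = begin
    m                     ≤⟨ <⇒≤ m< ⟩
    suc s * suc s         ≤⟨ *-mono-≤ (s≤s (m≤n+m s r)) (s≤s (m≤n+m s r)) ⟩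
    (s + s) * (s + s)     ≡⟨ double s ⟩
    4 * (s * s)           ∎
    where
    open ≤-Reasoning
    double : ∀ s → (s + s) * (s + s) ≡ 4 * (s * s)
    double = solve-∀

  ratio : ∀ m → √ m * suc (4 * C) * (√ m * suc (4 * C)) ≤ suc (4 * C) * suc (4 * C) * m
  ratio m with s , s²≤m , _ ← integer-sqrt m = begin
    s * suc (4 * C) * (s * suc (4 * C))         ≡⟨ square s (suc (4 * C)) ⟩
    suc (4 * C) * suc (4 * C) * (s * s)         ≤⟨ *-monoʳ-≤ (suc (4 * C) * suc (4 * C)) s²≤m ⟩
    suc (4 * C) * suc (4 * C) * m               ∎
    where
    open ≤-Reasoning
    square : ∀ s c → s * c * (s * c) ≡ c * c * (s * s)
    square = solve-∀
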